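{- For every $K_6$-free finite simple graph $G$ on $n$ vertices, $\tau_{B}(G) \le \frac{17 n^2}{100}$.
   Context: All graphs are finite, simple and undirected. $\tau_{B}(G)$ denotes the minimum size of a set of edges whose deletion from $G$ leaves a bipartite graph. $K_6$-free means $G$ contains no complete subgraph on $6$ vertices. -}

module Defs where

open import Data.Nat using (ℕ; _+_; _*_; _≤_; _<?_)
open import Data.Bool using (Bool; true; false; _∧_; not; T)
open import Data.Fin using (Fin; toℕ)
open import Data.List using (List; filter; length; concatMap; map; allFin)
open import Data.Product using (_×_; _,_; Σ; proj₁; proj₂)
open import Relation.Binary.PropositionalEquality using (_≡_; _≢_)
open import Relation.Nullary using (¬_)
open import Relation.Nullary.Decidable using (does)

record Graph (n : ℕ) : Set where
  field
    adj    : Fin n → Fin n → Bool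
    sym    : ∀ i j → adj i j ≡ adj j i
    irrefl : ∀ i → adj i i ≡ false
open Graph public

ContainsK : ∀ {n} → ℕ → Graph n → Set
ContainsK {n} k G =
  Σ (Fin k → Fin n) λ f →
    (∀ a b → a ≢ b → f a ≢ f b) × (∀ a b → a ≢ b → adj G (f a) (f b) ≡ true)

KFree : ∀ {n} → ℕ → Graph n → Set
KFree k G = ¬ ContainsK k G

pairs : (n : ℕ) → List (Fin n × Fin n)
pairs n = concatMap (λ i → map (λ j → (i , j))
                               (filter (λ j → toℕ i <? toℕ j) (allFin n)))
                    (allFin n)

countPairs : ∀ {n} → (Fin n → Fin n → Bool) → ℕ
countPairs {n} R = length (filter (λ p → Data.Bool._≟_ (R (proj₁ p) (proj₂ p)) true) (pairs n))
  where import Data.Bool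

IsBipartizingSet : ∀ {n} → Graph n → (Fin n → Fin n → Bool) → Set
IsBipartizingSet {n} G F =
  (∀ i j → F i j ≡ F j i) ×
  (∀ i j → F i j ≡ true → adj G i j ≡ true) ×
  Σ (Fin n → Bool) λ c →
    ∀ i j → adj G i j ≡ true → F i j ≡ false → c i ≢ c j

Rel : ℕ → Set
Rel n = Fin n → Fin n → Bool

{-# OPTIONS --safe #-}

-- With edge sets counted in ordered pairs, let the K₆-free graph have e edges.
-- Füredi's stability argument gives a partition into five classes with t inner
-- edges, where 5 (e + t) ≤ 4 n². Colour one class by a fixed half-cut h of the
-- inner edges and split the other four classes two against two. Over the 30
-- such colourings, an edge between classes is monochromatic 12 times, an inner
-- edge 24 times if h cuts it and 30 times otherwise, hence there are at most
-- 12 (e - t) + 27 t = 12 e + 15 t monochromatic edges in total. Together with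
-- six copies of a half-cut of the whole graph the total is at most
-- 15 (e + t) ≤ 12 n², so one of the 36 colourings has at most n² / 3
-- monochromatic ordered pairs, i.e. n² / 6 edges, and 1/6 < 17/100.
module Submission where

open import Defs
open import Data.Nat using (ℕ; _*_; _≤_)
open import Data.Product using (_×_; _,_; Σ)
open import Data.Nat.Properties
open import Algebra.Properties.Semiring.Sum +-*-semiring
  using (sum; sum-cong-≗; ∑-distrib-+; ∑-comm; *-distribˡ-sum; *-distribʳ-sum; sum-replicate-zero)
open import Data.Bool using (Bool; true; false; _∧_; not; if_then_else_)
open import Data.Bool.Properties using () renaming (_≟_ to _≟ᵇ_)
open import Data.Fin using (Fin; zero; suc; toℕ)
open import Data.Fin.Properties using (all?) renaming (_≟_ to _≟ᶠ_)
open import Data.List using (List; []; _∷_; filter; length; concatMap; map; allFin; tabulate)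
open import Data.List.Properties using (filter-++; length-++; map-tabulate)
open import Data.Nat using (zero; suc; _+_; _<_; _<?_; z≤n)
open import Data.Nat.ListAction using () renaming (sum to listSum)
open import Data.Nat.Tactic.RingSolver using (solve-∀)
open import Data.Product using (∃; proj₁; proj₂)
open import Data.Sum using (_⊎_; inj₁; inj₂)
open import Data.Vec using (Vec; []; _∷_; insertAt; lookup)
open import Function using (_∘_; id; const)
open import Level using (0ℓ)
open import Relation.Binary using (DecidableEquality)
open import Relation.Binary.PropositionalEquality as ≡
  using (_≡_; _≢_; refl; cong; cong₂; trans)
open import Relation.Nullary using (¬_; Dec; yes; no; does; contradiction)
open import Relation.Nullary.Decidable using (toWitness)
open import Relation.Unary using (Pred; Decidable)

private variable
  m n k : ℕ
  A B : Set

-- Finite sums, averages and maxima.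

sum-mono-≤ : {f g : Fin n → ℕ} → (∀ i → f i ≤ g i) → sum f ≤ sum g
sum-mono-≤ {zero}  f≤g = z≤n
sum-mono-≤ {suc n} f≤g = +-mono-≤ (f≤g zero) (sum-mono-≤ (f≤g ∘ suc))

sum-const : ∀ n {x} → sum {n} (const x) ≡ n * x
sum-const zero    = refl
sum-const (suc n) = cong (_ +_) (sum-const n)

∑∑ : (Fin m → Fin n → ℕ) → ℕ
∑∑ f = sum λ i → sum (f i)

∑∑-cong : {f g : Fin m → Fin n → ℕ} → (∀ i j → f i j ≡ g i j) → ∑∑ f ≡ ∑∑ g
∑∑-cong f≡g = sum-cong-≗ λ i → sum-cong-≗ (f≡g i)

∑∑-mono-≤ : {f g : Fin m → Fin n → ℕ} → (∀ i j → f i j ≤ g i j) → ∑∑ f ≤ ∑∑ g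
∑∑-mono-≤ f≤g = sum-mono-≤ λ i → sum-mono-≤ (f≤g i)

∑∑-distrib-+ : (f g : Fin m → Fin n → ℕ) →
  ∑∑ (λ i j → f i j + g i j) ≡ ∑∑ f + ∑∑ g
∑∑-distrib-+ f g =
  trans (sum-cong-≗ λ i → ∑-distrib-+ (f i) (g i)) (∑-distrib-+ (sum ∘ f) (sum ∘ g))

*-distribˡ-∑∑ : ∀ x (f : Fin m → Fin n → ℕ) → x * ∑∑ f ≡ ∑∑ (λ i j → x * f i j)
*-distribˡ-∑∑ x f =
  trans (*-distribˡ-sum x (sum ∘ f)) (sum-cong-≗ λ i → *-distribˡ-sum x (f i))

sum-∑∑-comm : (f : Fin k → Fin m → Fin n → ℕ) →
  sum (λ r → ∑∑ (f r)) ≡ ∑∑ (λ i j → sum λ r → f r i j)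
sum-∑∑-comm f =
  trans (∑-comm λ r i → sum (f r i)) (sum-cong-≗ λ i → ∑-comm λ r j → f r i j)

-- Peels off vertex 0: its diagonal entry, both orientations of each pair at 0, and the remaining
-- square. This is the form that induction on the number of vertices uses.
∑∑-suc : (f : Fin (suc n) → Fin (suc n) → ℕ) →
  ∑∑ f ≡ f zero zero + sum (λ j → f zero (suc j) + f (suc j) zero) + ∑∑ (λ i j → f (suc i) (suc j))
∑∑-suc f
  rewrite ∑-distrib-+ (λ i → f (suc i) zero) (λ i → sum λ j → f (suc i) (suc j))
        | ∑-distrib-+ (λ j → f zero (suc j)) (λ j → f (suc j) zero)
  = lemma (f zero zero) _ _ _
  where
  lemma : ∀ a b c d → (a + b) + (c + d) ≡ a + (b + c) + d
  lemma = solve-∀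

∃-≤average : (f : Fin (suc n) → ℕ) → ∃ λ i → suc n * f i ≤ sum f
∃-≤average {zero}  f = zero , ≤-refl
∃-≤average {suc n} f with ∃-≤average (f ∘ suc)
... | i , avg with ≤-total (f zero) (f (suc i))
...   | inj₁ ≤i = zero , +-monoʳ-≤ (f zero) (≤-trans (*-monoʳ-≤ (suc n) ≤i) avg)
...   | inj₂ i≤ = suc i , +-mono-≤ i≤ avg

-- Emptiness of `S` is a separate outcome because `füredi` then has no vertex to split off.
∃-maximal : (S : Fin n → Bool) (d : Fin n → ℕ) →
  (∀ i → S i ≡ false) ⊎ (∃ λ x → S x ≡ true × (∀ y → S y ≡ true → d y ≤ d x))
∃-maximal {zero}  S d = inj₁ λ ()
∃-maximal {suc n} S d with ∃-maximal (S ∘ suc) (d ∘ suc) | S zero in S0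
... | inj₁ empty        | false = inj₁ λ { zero → S0 ; (suc i) → empty i }
... | inj₁ empty        | true  = inj₂ (zero , S0 , λ
  { zero _ → ≤-refl ; (suc i) Si → contradiction (trans (≡.sym Si) (empty i)) λ () })
... | inj₂ (x , Sx , max) | false = inj₂ (suc x , Sx , λ
  { zero S0′ → contradiction (trans (≡.sym S0′) S0) λ () ; (suc i) → max i })
... | inj₂ (x , Sx , max) | true with ≤-total (d zero) (d (suc x))
...   | inj₁ ≤x = inj₂ (suc x , Sx , λ { zero _ → ≤x ; (suc i) → max i })
...   | inj₂ x≤ = inj₂ (zero , S0 , λ { zero _ → ≤-refl ; (suc i) Si → ≤-trans (max i Si) x≤ })

-- Edge counts and half-cuts.

⟦_⟧ : Bool → ℕ
⟦ b ⟧ = if b then 1 else 0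

-- Twice the number of edges when `R` is symmetric and irreflexive; counting ordered pairs keeps all
-- sums unrestricted.
edges : Rel n → ℕ
edges R = ∑∑ λ i j → ⟦ R i j ⟧

edges-∅ : {R : Rel n} → (∀ i j → R i j ≡ false) → edges R ≡ 0
edges-∅ {n} R≡∅ = trans (∑∑-cong λ i j → cong ⟦_⟧ (R≡∅ i j))
  (trans (sum-cong-≗ {n} λ i → sum-replicate-zero n) (sum-replicate-zero n))

monochromatic : DecidableEquality A → (Fin n → A) → Rel n → Rel n
monochromatic _≟_ c R i j = R i j ∧ does (c i ≟ c j)

-- Greedy: the vertex 0 takes the colour that is rarer among its neighbours.
half-cut : (R : Rel n) → (∀ i → R i i ≡ false) →
  ∃ λ c → 2 * edges (monochromatic _≟ᵇ_ c R) ≤ edges R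
half-cut {zero}  R irr = (λ ()) , z≤n
half-cut {suc n} R irr with half-cut (λ i j → R (suc i) (suc j)) (irr ∘ suc)
... | c′ , half = result
  where
  extend : Bool → Fin (suc n) → Bool
  extend b zero    = b
  extend b (suc i) = c′ i

  mono : Bool → Rel (suc n)
  mono b = monochromatic _≟ᵇ_ (extend b) R

  row : Rel (suc n) → ℕ
  row Q = sum λ j → ⟦ Q zero (suc j) ⟧ + ⟦ Q (suc j) zero ⟧

  edges-suc : (Q : Rel (suc n)) → Q zero zero ≡ false →
    edges Q ≡ row Q + edges (λ i j → Q (suc i) (suc j))
  edges-suc Q q rewrite ∑∑-suc (λ i j → ⟦ Q i j ⟧) | q = refl

  -- Each pair at vertex 0 is monochromatic for exactly one of the two colours of 0, so the smaller
  -- of the two rows is at most half of `row R`.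
  rows : row (mono true) + row (mono false) ≡ row R
  rows = trans (≡.sym (∑-distrib-+ {n} _ _)) (sum-cong-≗ λ j → pointwise (R zero (suc j)) (R (suc j) zero) (c′ j))
    where
    pointwise : ∀ r s b →
      (⟦ r ∧ does (true ≟ᵇ b) ⟧ + ⟦ s ∧ does (b ≟ᵇ true) ⟧) +
      (⟦ r ∧ does (false ≟ᵇ b) ⟧ + ⟦ s ∧ does (b ≟ᵇ false) ⟧) ≡ ⟦ r ⟧ + ⟦ s ⟧
    pointwise true  true  true  = refl
    pointwise true  true  false = refl
    pointwise true  false true  = refl
    pointwise true  false false = refl
    pointwise false true  true  = refl
    pointwise false true  false = refl
    pointwise false false true  = refl
    pointwise false false false = refl

  bound : ∀ b → 2 * row (mono b) ≤ row R → 2 * edges (mono b) ≤ edges R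
  bound b row≤ = begin
    2 * edges (mono b)                                   ≡⟨ cong (2 *_) (edges-suc (mono b) mono-irr) ⟩
    2 * (row (mono b) + edges mono′)                     ≡⟨ *-distribˡ-+ 2 (row (mono b)) (edges mono′) ⟩
    2 * row (mono b) + 2 * edges mono′                   ≤⟨ +-mono-≤ row≤ half ⟩
    row R + edges (λ i j → R (suc i) (suc j))            ≡⟨ edges-suc R (irr zero) ⟨
    edges R                                              ∎
    where
    open ≤-Reasoning
    mono′ = monochromatic _≟ᵇ_ c′ (λ i j → R (suc i) (suc j))
    mono-irr : mono b zero zero ≡ false
    mono-irr rewrite irr zero = refl

  result : ∃ λ c → 2 * edges (monochromatic _≟ᵇ_ c R) ≤ edges R
  result with ≤-total (row (mono true)) (row (mono false))
  ... | inj₁ t≤f = extend true , bound true (begin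
    2 * row (mono true)                   ≡⟨ cong (row (mono true) +_) (+-identityʳ _) ⟩
    row (mono true) + row (mono true)     ≤⟨ +-monoʳ-≤ (row (mono true)) t≤f ⟩
    row (mono true) + row (mono false)    ≡⟨ rows ⟩
    row R                                 ∎)
    where open ≤-Reasoning
  ... | inj₂ f≤t = extend false , bound false (begin
    2 * row (mono false)                  ≡⟨ cong (row (mono false) +_) (+-identityʳ _) ⟩
    row (mono false) + row (mono false)   ≤⟨ +-monoˡ-≤ (row (mono false)) f≤t ⟩
    row (mono true) + row (mono false)    ≡⟨ rows ⟩
    row R                                 ∎)
    where open ≤-Reasoning

-- Füredi's stability theorem.

Clique : Rel n → (Fin n → Bool) → ℕ → Set
Clique {n} R S k = Σ (Fin k → Fin n) λ f →
  (∀ a → S (f a) ≡ true) × (∀ a b → a ≢ b → R (f a) (f b) ≡ true)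

size : (Fin n → Bool) → ℕ
size S = sum λ i → ⟦ S i ⟧

-- The induced subgraph, kept on the vertex type `Fin n` so that the recursion into a neighbourhood
-- needs no reindexing.
_∣_ : Rel n → (Fin n → Bool) → Rel n
(R ∣ S) i j = S i ∧ S j ∧ R i j

2ab≤a²+b² : ∀ a b → 2 * (a * b) ≤ a * a + b * b
2ab≤a²+b² a b with ≤-total a b
... | inj₁ a≤b with m≤n⇒∃[o]m+o≡n a≤b
...   | o , refl = ≤-trans (m≤m+n _ (o * o)) (≤-reflexive (lemma a o))
  where
  lemma : ∀ a o → 2 * (a * (a + o)) + o * o ≡ a * a + (a + o) * (a + o)
  lemma = solve-∀
2ab≤a²+b² a b | inj₂ b≤a with m≤n⇒∃[o]m+o≡n b≤a
...   | o , refl = ≤-trans (m≤m+n _ (o * o)) (≤-reflexive (lemma b o))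
  where
  lemma : ∀ b o → 2 * ((b + o) * b) + o * o ≡ (b + o) * (b + o) + b * b
  lemma = solve-∀

-- With equality in the hypothesis, k+1 times the difference of the two sides
-- is (m − (k+1)v)².
turán-step : ∀ k m v t → suc k * t ≤ k * (m * m) →
  suc (suc k) * (t + 2 * (v * m)) ≤ suc k * ((v + m) * (v + m))
turán-step k m v t ih = *-cancelˡ-≤ (suc k) (begin
  suc k * (suc (suc k) * (t + 2 * (v * m)))                       ≡⟨ expand k m v t ⟩
  suc (suc k) * (suc k * t) + (suc k * suc (suc k)) * (2 * (v * m)) ≤⟨ +-monoˡ-≤ _ (*-monoʳ-≤ (suc (suc k)) ih) ⟩
  suc (suc k) * (k * (m * m)) + (suc k * suc (suc k)) * (2 * (v * m)) ≡⟨ regroup k m v ⟩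
  rest + 2 * ((suc k * v) * m)                                    ≤⟨ +-monoʳ-≤ rest (2ab≤a²+b² (suc k * v) m) ⟩
  rest + ((suc k * v) * (suc k * v) + m * m)                      ≡⟨ collect k m v ⟩
  suc k * (suc k * ((v + m) * (v + m)))                           ∎)
  where
  open ≤-Reasoning
  rest = (k * suc (suc k)) * (m * m) + suc k * suc k * (2 * (v * m))
  expand : ∀ k m v t → suc k * (suc (suc k) * (t + 2 * (v * m))) ≡
    suc (suc k) * (suc k * t) + (suc k * suc (suc k)) * (2 * (v * m))
  expand = solve-∀
  regroup : ∀ k m v → suc (suc k) * (k * (m * m)) + (suc k * suc (suc k)) * (2 * (v * m)) ≡
    (k * suc (suc k)) * (m * m) + suc k * suc k * (2 * (v * m)) + 2 * ((suc k * v) * m)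
  regroup = solve-∀
  collect : ∀ k m v → (k * suc (suc k)) * (m * m) + suc k * suc k * (2 * (v * m)) +
      ((suc k * v) * (suc k * v) + m * m) ≡
    suc k * (suc k * ((v + m) * (v + m)))
  collect = solve-∀

-- Füredi's stability argument: split off the non-neighbours V of a vertex of
-- maximal degree m, and recurse into its neighbourhood. The degrees of the
-- vertices in V sum to at most |V| m, and this sum counts the edges inside V twice.
füredi : (R : Rel n) → (∀ i j → R i j ≡ R j i) → ∀ k S → ¬ Clique R S (suc (suc k)) →
  ∃ λ (p : Fin n → Fin (suc k)) →
    suc k * (edges (R ∣ S) + edges (monochromatic _≟ᶠ_ p (R ∣ S))) ≤ k * (size S * size S)
-- Without a 2-clique `S` spans no edges, so one class suffices and both counts vanish.
füredi {n} R sym zero S free = const zero , ≤-reflexive (trans (*-identityˡ _)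
  (cong₂ _+_ (edges-∅ no-edge) (edges-∅ λ i j → cong (_∧ true) (no-edge i j))))
  where
  no-edge : ∀ i j → (R ∣ S) i j ≡ false
  no-edge i j with S i in Si | S j in Sj | R i j in Rij
  ... | false | _     | _     = refl
  ... | true  | false | _     = refl
  ... | true  | true  | false = refl
  ... | true  | true  | true  = contradiction
    ( (λ { zero → i ; (suc zero) → j })
    , (λ { zero → Si ; (suc zero) → Sj })
    , (λ { zero zero a≢a → contradiction refl a≢a
         ; zero (suc zero) _ → Rij
         ; (suc zero) zero _ → trans (sym j i) Rij
         ; (suc zero) (suc zero) a≢a → contradiction refl a≢a }))
    free
-- Degrees are measured inside `S`, which makes the maximal degree equal to `size N` below.
füredi {n} R sym (suc k) S free with ∃-maximal S (λ i → sum λ j → ⟦ S j ∧ R i j ⟧)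
... | inj₁ empty = const zero , ≤-trans (≤-reflexive trivial) z≤n
  where
  no-edge : ∀ i j → (R ∣ S) i j ≡ false
  no-edge i j rewrite empty i = refl
  trivial : suc (suc k) * (edges (R ∣ S) + edges (monochromatic _≟ᶠ_ (λ _ → zero {suc k}) (R ∣ S))) ≡ 0
  trivial = trans
    (cong (suc (suc k) *_) (cong₂ _+_ (edges-∅ no-edge) (edges-∅ λ i j → cong (_∧ true) (no-edge i j))))
    (*-zeroʳ k)
... | inj₂ (x , Sx , max) = p , (begin
  suc (suc k) * (edges (R ∣ S) + edges (monochromatic _≟ᶠ_ p (R ∣ S)))
    ≤⟨ *-monoʳ-≤ (suc (suc k)) split ⟩
  suc (suc k) * (t + 2 * (size V * size N))
    ≤⟨ turán-step k (size N) (size V) t (proj₂ ih) ⟩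
  suc k * ((size V + size N) * (size V + size N))
    ≡⟨ cong (λ s → suc k * (s * s)) size-split ⟩
  suc k * (size S * size S) ∎)
  where
  open ≤-Reasoning
  N V : Fin n → Bool
  N i = S i ∧ R x i
  V i = S i ∧ not (R x i)

  ∧-true : ∀ {a b} → a ∧ b ≡ true → a ≡ true × b ≡ true
  ∧-true {true} {true} _ = refl , refl

  -- `x` is adjacent to all of `N`, so it would extend a clique there by one vertex.
  N-free : ¬ Clique R N (suc (suc k))
  N-free (f , f∈N , adjacent) = free
    ( (λ { zero → x ; (suc a) → f a })
    , (λ { zero → Sx ; (suc a) → proj₁ (∧-true (f∈N a)) })
    , (λ { zero    zero    a≢a → contradiction refl a≢a
         ; zero    (suc b) _   → proj₂ (∧-true {S (f b)} (f∈N b))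
         ; (suc a) zero    _   → trans (sym (f a) x) (proj₂ (∧-true {S (f a)} (f∈N a)))
         ; (suc a) (suc b) a≢b → adjacent a b (a≢b ∘ cong suc) }))

  ih = füredi R sym k N N-free
  p′ = proj₁ ih
  t = edges (R ∣ N) + edges (monochromatic _≟ᶠ_ p′ (R ∣ N))

  -- Within `S`, the new class `zero` is exactly `V`, and the classes of `p′` on `N` are shifted by
  -- one; values outside `S` do not affect the count.
  p : Fin n → Fin (suc (suc k))
  p i = if R x i then suc (p′ i) else zero

  V→S : Fin n → Fin n → ℕ
  V→S i j = ⟦ V i ⟧ * ⟦ S j ∧ R i j ⟧

  V→S≤ : ∑∑ V→S ≤ size V * size N
  V→S≤ = begin
    ∑∑ V→S                                              ≡⟨ sum-cong-≗ (λ i → *-distribˡ-sum ⟦ V i ⟧ (λ j → ⟦ S j ∧ R i j ⟧)) ⟨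
    sum (λ i → ⟦ V i ⟧ * sum (λ j → ⟦ S j ∧ R i j ⟧))   ≤⟨ sum-mono-≤ degree ⟩
    sum (λ i → ⟦ V i ⟧ * size N)                        ≡⟨ *-distribʳ-sum (size N) (λ i → ⟦ V i ⟧) ⟨
    size V * size N                                     ∎
    where
    degree : ∀ i → ⟦ V i ⟧ * sum (λ j → ⟦ S j ∧ R i j ⟧) ≤ ⟦ V i ⟧ * size N
    degree i with S i in Si
    ... | true  = *-monoʳ-≤ ⟦ not (R x i) ⟧ (max i Si)
    ... | false = z≤n

  size-split : size V + size N ≡ size S
  size-split = trans (≡.sym (∑-distrib-+ {n} _ _)) (sum-cong-≗ λ i → pointwise (S i) (R x i))
    where
    pointwise : ∀ s r → ⟦ s ∧ not r ⟧ + ⟦ s ∧ r ⟧ ≡ ⟦ s ⟧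
    pointwise true  true  = refl
    pointwise true  false = refl
    pointwise false r     = refl

  -- An edge inside `V` counts twice on the left, as an edge and as an inner edge, and twice on the
  -- right, once from each endpoint. An edge between `V` and `N` counts once on both sides; inside
  -- `N` the terms for `p` and `p′` agree. Rewriting by symmetry lets one case split on `R i j`
  -- cover both orientations.
  pointwise : ∀ i j →
    ⟦ (R ∣ S) i j ⟧ + ⟦ monochromatic _≟ᶠ_ p (R ∣ S) i j ⟧ ≤
    (⟦ (R ∣ N) i j ⟧ + ⟦ monochromatic _≟ᶠ_ p′ (R ∣ N) i j ⟧) + (V→S i j + V→S j i)
  pointwise i j rewrite sym j i with S i | S j | R i j | R x i | R x j
  ... | false | _     | _     | _     | _     = z≤n
  ... | true  | false | _     | _     | _     = z≤n
  ... | true  | true  | false | false | _     = z≤n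
  ... | true  | true  | false | true  | _     = z≤n
  ... | true  | true  | true  | false | false = ≤-refl
  ... | true  | true  | true  | false | true  = ≤-refl
  ... | true  | true  | true  | true  | false = ≤-refl
  ... | true  | true  | true  | true  | true  = m≤m+n _ 0

  split : edges (R ∣ S) + edges (monochromatic _≟ᶠ_ p (R ∣ S)) ≤ t + 2 * (size V * size N)
  split = begin
    edges (R ∣ S) + edges (monochromatic _≟ᶠ_ p (R ∣ S))
      ≡⟨ ∑∑-distrib-+ {n} {n} _ _ ⟨
    ∑∑ {n} {n} (λ i j → ⟦ (R ∣ S) i j ⟧ + ⟦ monochromatic _≟ᶠ_ p (R ∣ S) i j ⟧)
      ≤⟨ ∑∑-mono-≤ pointwise ⟩
    ∑∑ {n} {n} (λ i j → (⟦ (R ∣ N) i j ⟧ + ⟦ monochromatic _≟ᶠ_ p′ (R ∣ N) i j ⟧) + (V→S i j + V→S j i))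
      ≡⟨ ∑∑-distrib-+ {n} {n} _ _ ⟩
    ∑∑ {n} {n} (λ i j → ⟦ (R ∣ N) i j ⟧ + ⟦ monochromatic _≟ᶠ_ p′ (R ∣ N) i j ⟧) + ∑∑ (λ i j → V→S i j + V→S j i)
      ≡⟨ cong₂ _+_ (∑∑-distrib-+ {n} {n} _ _) (∑∑-distrib-+ V→S (λ i j → V→S j i)) ⟩
    t + (∑∑ V→S + ∑∑ (λ i j → V→S j i))
      ≡⟨ cong (λ s → t + (∑∑ V→S + s)) (∑-comm V→S) ⟨
    t + (∑∑ V→S + ∑∑ V→S)
      ≤⟨ +-monoʳ-≤ t (+-mono-≤ V→S≤ V→S≤) ⟩
    t + (size V * size N + size V * size N)
      ≡⟨ cong (λ s → t + (size V * size N + s)) (+-identityʳ _) ⟨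
    t + 2 * (size V * size N) ∎

-- Balanced recolourings of five classes.

pattern₂₂ : Fin 6 → Vec (Bool → Bool) 4
pattern₂₂ r = lookup
  ( (𝟙 ∷ 𝟙 ∷ 𝟘 ∷ 𝟘 ∷ []) ∷ (𝟙 ∷ 𝟘 ∷ 𝟙 ∷ 𝟘 ∷ []) ∷ (𝟙 ∷ 𝟘 ∷ 𝟘 ∷ 𝟙 ∷ [])
  ∷ (𝟘 ∷ 𝟘 ∷ 𝟙 ∷ 𝟙 ∷ []) ∷ (𝟘 ∷ 𝟙 ∷ 𝟘 ∷ 𝟙 ∷ []) ∷ (𝟘 ∷ 𝟙 ∷ 𝟙 ∷ 𝟘 ∷ []) ∷ []) r
  where
  𝟘 𝟙 : Bool → Bool
  𝟘 = const false
  𝟙 = const true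

-- Patterns consist of functions of a vertex's own bit: the inserted `id` makes class `a` follow
-- that bit, while the constants give each other class a single colour.
recolour : Fin 5 → Fin 6 → Fin 5 → Bool → Bool
recolour a r = lookup (insertAt (pattern₂₂ r) a id)

-- For `x ≢ y`, each of the three `a` outside both classes gives 2 agreements among the six
-- patterns. Each of the two remaining `a` gives 3, whatever the bits, since the patterns come in
-- complementary pairs: 6 + 6 = 12. For `x ≡ y`, the four other `a` always agree, giving 24, and
-- `a ≡ x` adds 6 exactly when the bits agree.
recolour-count : ∀ x y b b′ →
  ∑∑ (λ a r → ⟦ does (recolour a r x b ≟ᵇ recolour a r y b′) ⟧) ≡
  12 + (12 * ⟦ does (x ≟ᶠ y) ⟧ + 6 * ⟦ does (x ≟ᶠ y) ∧ does (b ≟ᵇ b′) ⟧)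
recolour-count x y b b′ = by-cases b b′ x y
  where
  Count : Bool → Bool → Fin 5 → Fin 5 → Set
  Count b b′ x y =
    ∑∑ (λ a r → ⟦ does (recolour a r x b ≟ᵇ recolour a r y b′) ⟧) ≡
    12 + (12 * ⟦ does (x ≟ᶠ y) ⟧ + 6 * ⟦ does (x ≟ᶠ y) ∧ does (b ≟ᵇ b′) ⟧)

  count? : ∀ b b′ → Dec (∀ x y → Count b b′ x y)
  count? b b′ = all? λ x → all? λ y → _ ≟ _

  -- `all?` enumerates the classes only, so the two bits are split by hand and each of the four
  -- tables is decided by evaluation.
  by-cases : ∀ b b′ x y → Count b b′ x y
  by-cases true  true  = toWitness {a? = count? true true} _
  by-cases true  false = toWitness {a? = count? true false} _
  by-cases false true  = toWitness {a? = count? false true} _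
  by-cases false false = toWitness {a? = count? false false} _

-- Averaging over rows and then within the chosen row gives an entry with 36 times its value at most
-- `12 * z`.
∃∃-≤average : (f : Fin 6 → Fin 6 → ℕ) → ∀ z → ∑∑ f ≤ 12 * z → ∃ λ a → ∃ λ r → 3 * f a r ≤ z
∃∃-≤average f z total =
  let a , avg-a = ∃-≤average (λ a → sum (f a))
      r , avg-r = ∃-≤average (f a)
  in a , r , scale (f a r) (sum (f a)) (∑∑ f) z avg-r avg-a total
  where
  scale : ∀ x s t z → 6 * x ≤ s → 6 * s ≤ t → t ≤ 12 * z → 3 * x ≤ z
  scale x s t z 6x≤s 6s≤t t≤12z = *-cancelˡ-≤ 12 (begin
    12 * (3 * x)   ≡⟨ *-assoc 12 3 x ⟨
    6 * 6 * x      ≡⟨ *-assoc 6 6 x ⟩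
    6 * (6 * x)    ≤⟨ *-monoʳ-≤ 6 6x≤s ⟩
    6 * s          ≤⟨ 6s≤t ⟩
    t              ≤⟨ t≤12z ⟩
    12 * z         ∎)
    where open ≤-Reasoning

module _ (R : Rel n) (p : Fin n → Fin 5) (g h : Fin n → Bool) where

  private
    inner : Rel n
    inner = monochromatic _≟ᶠ_ p R

    -- Row `zero` ignores `r`, so `g` enters with weight six and the average runs over a full 6 by 6
    -- grid.
    colouring : Fin 6 → Fin 6 → Fin n → Bool
    colouring zero    r i = g i
    colouring (suc a) r i = recolour a r (p i) (h i)

    mono : Fin 6 → Fin 6 → Rel n
    mono a r = monochromatic _≟ᵇ_ (colouring a r) R

    mono-g mono-h : Rel n
    mono-g = monochromatic _≟ᵇ_ g R
    mono-h = monochromatic _≟ᵇ_ h inner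

    M : Fin 6 → Fin 6 → ℕ
    M a r = edges (mono a r)

    -- Exchanging the sums reduces the claim to one ordered pair, where `recolour-count` applies.
    recoloured : ∑∑ (M ∘ suc) ≡ 12 * edges R + (12 * edges inner + 6 * edges mono-h)
    recoloured = begin
      ∑∑ (M ∘ suc)
        ≡⟨ sum-cong-≗ (λ a → sum-∑∑-comm λ r i j → ⟦ mono (suc a) r i j ⟧) ⟩
      sum (λ a → ∑∑ λ i j → sum λ r → ⟦ mono (suc a) r i j ⟧)
        ≡⟨ sum-∑∑-comm (λ a i j → sum λ r → ⟦ mono (suc a) r i j ⟧) ⟩
      ∑∑ (λ i j → ∑∑ λ a r → ⟦ mono (suc a) r i j ⟧)
        ≡⟨ ∑∑-cong pointwise ⟩
      ∑∑ (λ i j → 12 * ⟦ R i j ⟧ + (12 * ⟦ inner i j ⟧ + 6 * ⟦ mono-h i j ⟧))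
        ≡⟨ ∑∑-distrib-+ (λ i j → 12 * ⟦ R i j ⟧) (λ i j → 12 * ⟦ inner i j ⟧ + 6 * ⟦ mono-h i j ⟧) ⟩
      ∑∑ (λ i j → 12 * ⟦ R i j ⟧) + ∑∑ (λ i j → 12 * ⟦ inner i j ⟧ + 6 * ⟦ mono-h i j ⟧)
        ≡⟨ cong (∑∑ (λ i j → 12 * ⟦ R i j ⟧) +_)
             (∑∑-distrib-+ (λ i j → 12 * ⟦ inner i j ⟧) (λ i j → 6 * ⟦ mono-h i j ⟧)) ⟩
      ∑∑ (λ i j → 12 * ⟦ R i j ⟧) + (∑∑ (λ i j → 12 * ⟦ inner i j ⟧) + ∑∑ (λ i j → 6 * ⟦ mono-h i j ⟧))
        ≡⟨ cong₂ _+_ (*-distribˡ-∑∑ 12 (λ i j → ⟦ R i j ⟧))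
             (cong₂ _+_ (*-distribˡ-∑∑ 12 (λ i j → ⟦ inner i j ⟧)) (*-distribˡ-∑∑ 6 (λ i j → ⟦ mono-h i j ⟧))) ⟨
      12 * edges R + (12 * edges inner + 6 * edges mono-h) ∎
      where
      open ≡.≡-Reasoning
      pointwise : ∀ i j → ∑∑ (λ a r → ⟦ mono (suc a) r i j ⟧) ≡
        12 * ⟦ R i j ⟧ + (12 * ⟦ inner i j ⟧ + 6 * ⟦ mono-h i j ⟧)
      pointwise i j with R i j
      ... | true  = recolour-count (p i) (p j) (h i) (h j)
      ... | false = refl

    -- The weight six on `x` is chosen so that `6 * x` is at most `3 * e`, raising the coefficient
    -- of `e` from 12 to the 15 of `i`; only then does the bound on `e + i` apply.
    total-≤ : ∀ e i x y z → 2 * x ≤ e → 2 * y ≤ i → 5 * (e + i) ≤ 4 * z →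
      6 * x + (12 * e + (12 * i + 6 * y)) ≤ 12 * z
    total-≤ e i x y z 2x≤e 2y≤i 5[e+i]≤4z = begin
      6 * x + (12 * e + (12 * i + 6 * y))                 ≡⟨ regroup x e i y ⟩
      (3 * (2 * x) + 12 * e) + (12 * i + 3 * (2 * y))     ≤⟨ +-mono-≤ (+-monoˡ-≤ (12 * e) (*-monoʳ-≤ 3 2x≤e))
                                                                       (+-monoʳ-≤ (12 * i) (*-monoʳ-≤ 3 2y≤i)) ⟩
      (3 * e + 12 * e) + (12 * i + 3 * i)                 ≡⟨ collect e i ⟩
      3 * (5 * (e + i))                                   ≤⟨ *-monoʳ-≤ 3 5[e+i]≤4z ⟩
      3 * (4 * z)                                         ≡⟨ *-assoc 3 4 z ⟨
      12 * z                                              ∎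
      where
      open ≤-Reasoning
      regroup : ∀ x e i y → 6 * x + (12 * e + (12 * i + 6 * y)) ≡ (3 * (2 * x) + 12 * e) + (12 * i + 3 * (2 * y))
      regroup = solve-∀
      collect : ∀ e i → (3 * e + 12 * e) + (12 * i + 3 * i) ≡ 3 * (5 * (e + i))
      collect = solve-∀

    total : ∀ z → 2 * edges mono-g ≤ edges R → 2 * edges mono-h ≤ edges inner →
      5 * (edges R + edges inner) ≤ 4 * z → ∑∑ M ≤ 12 * z
    total z g-half h-half partition = ≤-trans
      (≤-reflexive (cong₂ _+_ (sum-const 6 {edges mono-g}) recoloured))
      (total-≤ (edges R) (edges inner) (edges mono-g) (edges mono-h) z g-half h-half partition)

  average-recolouring : ∀ z → 2 * edges mono-g ≤ edges R → 2 * edges mono-h ≤ edges inner →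
    5 * (edges R + edges inner) ≤ 4 * z →
    ∃ λ c → 3 * edges (monochromatic _≟ᵇ_ c R) ≤ z
  average-recolouring z g-half h-half partition =
    let a , r , avg = ∃∃-≤average M z (total z g-half h-half partition)
    in colouring a r , avg

sparse-bipartition : (R : Rel n) → (∀ i j → R i j ≡ R j i) → (∀ i → R i i ≡ false) →
  ¬ Clique R (const true) 6 →
  ∃ λ c → 3 * edges (monochromatic _≟ᵇ_ c R) ≤ n * n
sparse-bipartition {n} R sym irr free
  -- `k = 4` matches a forbidden 6-clique and five classes. With `const true` the restriction
  -- `R ∣ S` reduces to `R` by computation, so only the size of `S` has to be rewritten.
  with p , partition ← füredi R sym 4 (const true) free
  with g , g-half ← half-cut R irr
  with h , h-half ← half-cut (monochromatic _≟ᶠ_ p R) (λ i → cong (_∧ does (p i ≟ᶠ p i)) (irr i))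
  = average-recolouring R p g h (n * n) g-half h-half
      (≡.subst (λ s → 5 * (edges R + edges (monochromatic _≟ᶠ_ p R)) ≤ 4 * (s * s)) size-all partition)
  where
  size-all : size {n} (const true) ≡ n
  size-all = trans (sum-const n {1}) (*-identityʳ n)

-- From double sums to lists of unordered pairs.

length-filter-concatMap : {P : Pred B 0ℓ} (P? : Decidable P) (f : A → List B) (xs : List A) →
  length (filter P? (concatMap f xs)) ≡ listSum (map (length ∘ filter P? ∘ f) xs)
length-filter-concatMap P? f []       = refl
length-filter-concatMap P? f (x ∷ xs)
  rewrite filter-++ P? (f x) (concatMap f xs) | length-++ (filter P? (f x)) {filter P? (concatMap f xs)}
  = cong (_ +_) (length-filter-concatMap P? f xs)

length-filter-map-filter : {P : Pred B 0ℓ} (P? : Decidable P) {Q : Pred A 0ℓ} (Q? : Decidable Q)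
  (g : A → B) (xs : List A) →
  length (filter P? (map g (filter Q? xs))) ≡ listSum (map (λ x → ⟦ does (Q? x) ∧ does (P? (g x)) ⟧) xs)
length-filter-map-filter P? Q? g []       = refl
length-filter-map-filter P? Q? g (x ∷ xs) with does (Q? x)
... | false = length-filter-map-filter P? Q? g xs
... | true with does (P? (g x))
...   | false = length-filter-map-filter P? Q? g xs
...   | true  = cong suc (length-filter-map-filter P? Q? g xs)

sum-map-allFin : (f : Fin n → ℕ) → listSum (map f (allFin n)) ≡ sum f
sum-map-allFin f = trans (cong listSum (map-tabulate id f)) (sum-tabulate f)
  where
  sum-tabulate : ∀ {n} (f : Fin n → ℕ) → listSum (tabulate f) ≡ sum f
  sum-tabulate {zero}  f = refl
  sum-tabulate {suc n} f = cong (f zero +_) (sum-tabulate (f ∘ suc))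

-- At most one of `i < j` and `j < i` holds, so the upper triangle and its transpose together fit
-- inside `R`. On the diagonal neither holds, hence an inequality.
2*countPairs≤edges : (R : Rel n) → (∀ i j → R i j ≡ R j i) → 2 * countPairs R ≤ edges R
2*countPairs≤edges {n} R sym = begin
  2 * countPairs R                                        ≡⟨ cong (2 *_) countPairs≡ ⟩
  2 * ∑∑ upper                                            ≡⟨ cong (∑∑ upper +_) (+-identityʳ _) ⟩
  ∑∑ upper + ∑∑ upper                                     ≡⟨ cong (∑∑ upper +_) (∑-comm upper) ⟩
  ∑∑ upper + ∑∑ (λ i j → upper j i)                       ≡⟨ ∑∑-distrib-+ upper (λ i j → upper j i) ⟨
  ∑∑ (λ i j → upper i j + upper j i)                      ≤⟨ ∑∑-mono-≤ pointwise ⟩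
  edges R                                                 ∎
  where
  open ≤-Reasoning
  upper : Fin n → Fin n → ℕ
  upper i j = ⟦ does (toℕ i <? toℕ j) ∧ does (R i j ≟ᵇ true) ⟧

  R? : Decidable (λ (q : Fin n × Fin n) → R (proj₁ q) (proj₂ q) ≡ true)
  R? q = R (proj₁ q) (proj₂ q) ≟ᵇ true

  later : Fin n → List (Fin n × Fin n)
  later i = map (i ,_) (filter (λ j → toℕ i <? toℕ j) (allFin n))

  countPairs≡ : countPairs R ≡ ∑∑ upper
  countPairs≡ = begin-equality
    countPairs R                                        ≡⟨ length-filter-concatMap R? later (allFin n) ⟩
    listSum (map (length ∘ filter R? ∘ later) (allFin n))  ≡⟨ sum-map-allFin (length ∘ filter R? ∘ later) ⟩
    sum (length ∘ filter R? ∘ later)                    ≡⟨ sum-cong-≗ (λ i → trans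
      (length-filter-map-filter R? (λ j → toℕ i <? toℕ j) (i ,_) (allFin n)) (sum-map-allFin (upper i))) ⟩
    ∑∑ upper                                            ∎

  pointwise : ∀ i j → upper i j + upper j i ≤ ⟦ R i j ⟧
  pointwise i j rewrite sym j i = exclusive (toℕ i <? toℕ j) (toℕ j <? toℕ i) (R i j)
    where
    exclusive : ∀ {x y} (x<y? : Dec (x < y)) (y<x? : Dec (y < x)) b →
      ⟦ does x<y? ∧ does (b ≟ᵇ true) ⟧ + ⟦ does y<x? ∧ does (b ≟ᵇ true) ⟧ ≤ ⟦ b ⟧
    exclusive (yes x<y) (yes y<x) b     = contradiction y<x (<-asym x<y)
    exclusive (yes _)   (no _)    true  = ≤-refl
    exclusive (yes _)   (no _)    false = z≤n
    exclusive (no _)    (yes _)   true  = ≤-refl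
    exclusive (no _)    (yes _)   false = z≤n
    exclusive (no _)    (no _)    b     = z≤n

-- Bipartizing sets and the final bound.

monochromatic-bipartizes : (G : Graph n) (c : Fin n → Bool) →
  IsBipartizingSet G (monochromatic _≟ᵇ_ c (adj G))
monochromatic-bipartizes G c =
  (λ i j → cong₂ _∧_ (Graph.sym G i j) (swap (c i) (c j))) , F⊆G , c , proper
  where
  swap : ∀ a b → does (a ≟ᵇ b) ≡ does (b ≟ᵇ a)
  swap true  true  = refl
  swap true  false = refl
  swap false true  = refl
  swap false false = refl

  F⊆G : ∀ i j → monochromatic _≟ᵇ_ c (adj G) i j ≡ true → adj G i j ≡ true
  F⊆G i j Fij with adj G i j
  ... | true = refl

  proper : ∀ i j → adj G i j ≡ true → monochromatic _≟ᵇ_ c (adj G) i j ≡ false → c i ≢ c j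
  proper i j Gij Fij ci≡cj with adj G i j | c i | c j
  proper i j refl () refl | true | true  | true
  proper i j refl () refl | true | false | false

-- Adjacency already forces injectivity: two indices with the same image would give a loop.
KFree⇒¬Clique : (G : Graph n) → KFree k G → ¬ Clique (adj G) (const true) k
KFree⇒¬Clique G free (f , _ , adjacent) = free (f , distinct , adjacent)
  where
  distinct : ∀ a b → a ≢ b → f a ≢ f b
  distinct a b a≢b fa≡fb = contradiction
    (trans (≡.sym (adjacent a b a≢b)) (trans (cong (adj G (f a)) (≡.sym fa≡fb)) (irrefl G (f a)))) λ ()

100x≤17y : ∀ x e y → 2 * x ≤ e → 3 * e ≤ y → 100 * x ≤ 17 * y
100x≤17y x e y 2x≤e 3e≤y = begin
  -- Here 100 is relaxed to 102 = 17 · 6, giving away the gap between 1/6 and 17/100.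
  100 * x             ≤⟨ *-monoˡ-≤ x (m≤m+n 100 2) ⟩
  17 * 6 * x          ≡⟨ *-assoc 17 6 x ⟩
  17 * (6 * x)        ≡⟨ cong (17 *_) (*-assoc 3 2 x) ⟩
  17 * (3 * (2 * x))  ≤⟨ *-monoʳ-≤ 17 (*-monoʳ-≤ 3 2x≤e) ⟩
  17 * (3 * e)        ≤⟨ *-monoʳ-≤ 17 3e≤y ⟩
  17 * y              ∎
  where open ≤-Reasoning

sparse-bipartition⇒bipartizing : (G : Graph n) →
  (∃ λ c → 3 * edges (monochromatic _≟ᵇ_ c (adj G)) ≤ n * n) →
  Σ (Rel n) λ F → IsBipartizingSet G F × 100 * countPairs F ≤ 17 * (n * n)
sparse-bipartition⇒bipartizing {n} G (c , sparse) =
  F , bipartizing ,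
  100x≤17y (countPairs F) (edges F) (n * n) (2*countPairs≤edges F (proj₁ bipartizing)) sparse
  where
  F = monochromatic _≟ᵇ_ c (adj G)
  bipartizing = monochromatic-bipartizes G c

theorem4p10 : (n : ℕ) (G : Graph n) → KFree 6 G →
    Σ (Rel n) λ F → IsBipartizingSet G F × 100 * countPairs F ≤ 17 * (n * n)
theorem4p10 n G free = sparse-bipartition⇒bipartizing G
  (sparse-bipartition (adj G) (Graph.sym G) (irrefl G) (KFree⇒¬Clique G free))
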